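{- Let $(G,i)$ be a filter pair over $\Sigma$ and $A$ a $\Sigma$-structure. Then the closure operator on $A$ associated to the consequence relation $\vdash_G^A$ on $A$ is the one given by $i_A\circ\Xi(i)_A$; that is, for all $D\subseteq A$ and $a\in A$, $D\vdash_G^A a$ if and only if $a\in i_A(\Xi(i)_A(D))$.
   Context: $\Sigma$-Str is the category of $\Sigma$-structures and homomorphisms. $AL$ is the category of algebraic lattices with maps preserving arbitrary meets and directed joins. A filter pair over $\Sigma$ is a pair $(G,i)$ of a contravariant functor $G:\Sigma\text{ -Str}\to AL$ and maps $i_A:G(A)\to(\mathcal{P}(A),\subseteq)$, one for each $\Sigma$-structure $A$, preserving arbitrary infima (in particular $i_A(\top)=A$) and directed suprema, such that $i_A\circ G(h)=h^{ -1}\circ i_B$ for every homomorphism $h:A\to B$. The consequence relation $\vdash_G^A$ on $A$: $D\vdash_G^A a$ iff for every $z\in G(A)$, $D\subseteq i_A(z)$ implies $a\in i_A(z)$. Since $i_A$ preserves arbitrary infima it has a unique left adjoint, denoted $\Xi(i)_A:\mathcal{P}(A)\to G(A)$; thus $\Xi(i)_A(D)\leq z\iff D\subseteq i_A(z)$. -}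

module Defs where

open import Data.Bool.Base using (Bool; true; false)
open import Data.Nat.Base using (ℕ)
open import Data.Product.Base using (Σ-syntax; ∃-syntax; _×_; _,_; proj₁; proj₂)
open import Data.Vec.Base using (Vec; map)
open import Data.Vec.Properties using (map-id; map-∘)
open import Function.Base using (_∘_; id)
open import Level using (Level; suc; _⊔_; Lift; lift)
open import Relation.Binary.Bundles using (Poset)
open import Relation.Binary.Definitions using (Adjoint)
open import Relation.Binary.PropositionalEquality.Core
  using (_≡_; refl; sym; trans; cong; subst)
open import Relation.Unary using (Pred; _∈_; _⊆_; _≐_; _⊢_)
open import Relation.Unary.Relation.Binary.Subset using (⊆-poset)

private
  variable
    a c ℓ₁ ℓ₂ p s : Level
    c′ ℓ₁′ ℓ₂′ : Level

------------------------------------------------------------------------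
-- Σ-structures

-- Relation symbols are allowed; purely algebraic signatures are those
-- with every Rel n empty.

record Signature s : Set (suc s) where
  field
    Op  : ℕ → Set s
    Rel : ℕ → Set s

record Structure (Sg : Signature s) a : Set (s ⊔ suc a) where
  open Signature Sg
  field
    Carrier : Set a
    op      : ∀ {n} → Op n → Vec Carrier n → Carrier
    rel     : ∀ {n} → Rel n → Pred (Vec Carrier n) a

record Hom {Sg : Signature s} (A B : Structure Sg a) : Set (s ⊔ a) where
  open Signature Sg
  private
    module A = Structure A
    module B = Structure B
  field
    fun  : A.Carrier → B.Carrier
    pres : ∀ {n} (f : Op n) xs → fun (A.op f xs) ≡ B.op f (map fun xs)
    resp : ∀ {n} (r : Rel n) xs → xs ∈ A.rel r → map fun xs ∈ B.rel r

module _ {Sg : Signature s} where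

  open Hom

  idHom : (A : Structure Sg a) → Hom A A
  idHom A .fun = id
  idHom A .pres f xs = cong (Structure.op A f) (sym (map-id xs))
  idHom A .resp r xs = subst (Structure.rel A r) (sym (map-id xs))

  infixr 9 _∘ʰ_
  _∘ʰ_ : {A B C : Structure Sg a} → Hom B C → Hom A B → Hom A C
  (g ∘ʰ h) .fun = fun g ∘ fun h
  _∘ʰ_ {C = C} g h .pres f xs =
    trans (cong (fun g) (pres h f xs))
    (trans (pres g f (map (fun h) xs))
           (cong (Structure.op C f) (sym (map-∘ (fun g) (fun h) xs))))
  _∘ʰ_ {C = C} g h .resp r xs r-xs =
    subst (Structure.rel C r) (sym (map-∘ (fun g) (fun h) xs))
          (resp g r (map (fun h) xs) (resp h r xs r-xs))

------------------------------------------------------------------------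
-- Infima and suprema of arbitrary families

-- A subset S of a poset is represented by the family Σ x ∶ P , x ∈ S → P.

module _ (P : Poset c ℓ₁ ℓ₂) where

  open Poset P

  IsInfimum : {I : Set p} → (I → Carrier) → Carrier → Set _
  IsInfimum x m = (∀ j → m ≤ x j) × (∀ w → (∀ j → w ≤ x j) → w ≤ m)

  IsSupremum : {I : Set p} → (I → Carrier) → Carrier → Set _
  IsSupremum x m = (∀ j → x j ≤ m) × (∀ w → (∀ j → x j ≤ w) → m ≤ w)

  -- The first component makes directed families nonempty.
  IsDirected : {I : Set p} → (I → Carrier) → Set _
  IsDirected {I = I} x = I × (∀ j k → ∃[ l ] (x j ≤ x l × x k ≤ x l))

  Compact : (p : Level) → Carrier → Set _
  Compact p k = {I : Set p} (x : I → Carrier) (m : Carrier) →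
    IsDirected x → IsSupremum x m → k ≤ m → ∃[ j ] k ≤ x j

module _ (p : Level) (P : Poset c ℓ₁ ℓ₂) (Q : Poset c′ ℓ₁′ ℓ₂′)
         (f : Poset.Carrier P → Poset.Carrier Q) where

  PreservesInfima : Set _
  PreservesInfima = {I : Set p} (x : I → Poset.Carrier P) (m : Poset.Carrier P) →
    IsInfimum P x m → IsInfimum Q (f ∘ x) (f m)

  PreservesDirectedSuprema : Set _
  PreservesDirectedSuprema =
    {I : Set p} (x : I → Poset.Carrier P) (m : Poset.Carrier P) →
    IsDirected P x → IsSupremum P x m → IsSupremum Q (f ∘ x) (f m)

------------------------------------------------------------------------
-- Algebraic lattices

-- The level p bounds the index sets of the families considered.

record AlgebraicLattice c ℓ₁ ℓ₂ p : Set (suc (c ⊔ ℓ₁ ⊔ ℓ₂ ⊔ p)) where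
  field
    poset : Poset c ℓ₁ ℓ₂

  open Poset poset public

  field
    ⋀         : {I : Set p} → (I → Carrier) → Carrier
    ⋀-infimum : {I : Set p} (x : I → Carrier) → IsInfimum poset x (⋀ x)
    ⋁          : {I : Set p} → (I → Carrier) → Carrier
    ⋁-supremum : {I : Set p} (x : I → Carrier) → IsSupremum poset x (⋁ x)
    algebraic : ∀ y →
      IsSupremum poset {I = Σ[ k ∈ Carrier ] (Compact poset p k × k ≤ y)} proj₁ y

record ALMap (L M : AlgebraicLattice c ℓ₁ ℓ₂ p) : Set (c ⊔ ℓ₂ ⊔ suc p) where
  private
    module L = AlgebraicLattice L
    module M = AlgebraicLattice M
  field
    fun                 : L.Carrier → M.Carrier
    preserves-infima    : PreservesInfima p L.poset M.poset fun
    preserves-directed  : PreservesDirectedSuprema p L.poset M.poset fun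

------------------------------------------------------------------------
-- The left adjoint of an infimum-preserving map

module _ {P : Poset c ℓ₁ ℓ₂} {Q : Poset c′ ℓ₁′ ℓ₂′}
         {f : Poset.Carrier P → Poset.Carrier Q} where

  private
    module P = Poset P
    module Q = Poset Q

  preservesInfima⇒monotone : PreservesInfima p P Q f →
                             ∀ {x y} → x P.≤ y → f x Q.≤ f y
  preservesInfima⇒monotone {p = p} pres {x} {y} x≤y =
    proj₁ (pres pair x (lower , λ w w≤ → w≤ (lift true))) (lift false)
    where
    pair : Lift p Bool → P.Carrier
    pair (lift true)  = x
    pair (lift false) = y

    lower : ∀ j → x P.≤ pair j
    lower (lift true)  = P.refl
    lower (lift false) = x≤y

  leftAdjoint-unique : ∀ {g h} → Adjoint Q._≤_ P._≤_ g f →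
                       Adjoint Q._≤_ P._≤_ h f → ∀ q → g q P.≈ h q
  leftAdjoint-unique {g} {h} g⊣f h⊣f q = P.antisym
    (proj₂ (g⊣f {q} {h q}) (proj₁ (h⊣f {q} {h q}) P.refl))
    (proj₂ (h⊣f {q} {g q}) (proj₁ (g⊣f {q} {g q}) P.refl))

module _ (L : AlgebraicLattice c ℓ₁ ℓ₂ (c ⊔ ℓ₂′)) (Q : Poset c′ ℓ₁′ ℓ₂′)
         {f : AlgebraicLattice.Carrier L → Poset.Carrier Q}
         (pres : PreservesInfima (c ⊔ ℓ₂′) (AlgebraicLattice.poset L) Q f) where

  private
    module L = AlgebraicLattice L
    module Q = Poset Q

    above : ∀ q → Σ[ z ∈ L.Carrier ] q Q.≤ f z → L.Carrier
    above q = proj₁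

  leftAdjoint : Q.Carrier → L.Carrier
  leftAdjoint q = L.⋀ (above q)

  leftAdjoint-adjoint : Adjoint Q._≤_ L._≤_ leftAdjoint f
  leftAdjoint-adjoint {q} {z} =
      (λ Ξq≤z → Q.trans unit (preservesInfima⇒monotone {P = L.poset} {Q = Q} pres Ξq≤z))
    , (λ q≤fz → proj₁ (L.⋀-infimum (above q)) (z , q≤fz))
    where
    unit : q Q.≤ f (leftAdjoint q)
    unit = proj₂ (pres (above q) (leftAdjoint q) (L.⋀-infimum (above q))) q proj₂

------------------------------------------------------------------------
-- Filter pairs

-- Hom-sets carry pointwise equality, which G₁ is required to respect.

record ContravariantFunctor (Sg : Signature s) a c ℓ₁ ℓ₂ p
    : Set (s ⊔ suc (a ⊔ c ⊔ ℓ₁ ⊔ ℓ₂ ⊔ p)) where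
  field
    G₀ : Structure Sg a → AlgebraicLattice c ℓ₁ ℓ₂ p
    G₁ : ∀ {A B} → Hom A B → ALMap (G₀ B) (G₀ A)

  module Lat A = AlgebraicLattice (G₀ A)

  ∣_∣ : Structure Sg a → Set c
  ∣ A ∣ = Lat.Carrier A

  G⟨_⟩ : ∀ {A B} → Hom A B → ∣ B ∣ → ∣ A ∣
  G⟨ h ⟩ = ALMap.fun (G₁ h)

  field
    G-resp : ∀ {A B} {g h : Hom A B} → (∀ x → Hom.fun g x ≡ Hom.fun h x) →
             ∀ z → Lat._≈_ A (G⟨ g ⟩ z) (G⟨ h ⟩ z)
    G-id   : ∀ {A} z → Lat._≈_ A (G⟨ idHom A ⟩ z) z
    G-∘    : ∀ {A B C} (g : Hom B C) (h : Hom A B) z →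
             Lat._≈_ A (G⟨ g ∘ʰ h ⟩ z) (G⟨ h ⟩ (G⟨ g ⟩ z))

-- Families are indexed by sets of level a ⊔ c, so that for D ⊆ A they
-- include { z ∈ G(A) ∣ D ⊆ i_A(z) }.

record FilterPair (Sg : Signature s) a c ℓ₁ ℓ₂
    : Set (s ⊔ suc (a ⊔ c ⊔ ℓ₁ ⊔ ℓ₂)) where
  field
    G : ContravariantFunctor Sg a c ℓ₁ ℓ₂ (a ⊔ c)

  open ContravariantFunctor G public

  𝒫 : Structure Sg a → Poset (suc a) a a
  𝒫 A = ⊆-poset (Structure.Carrier A) a

  field
    i : (A : Structure Sg a) → ∣ A ∣ → Pred (Structure.Carrier A) a
    i-preserves-infima : ∀ A →
      PreservesInfima (a ⊔ c) (Lat.poset A) (𝒫 A) (i A)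
    i-preserves-directed : ∀ A →
      PreservesDirectedSuprema (a ⊔ c) (Lat.poset A) (𝒫 A) (i A)
    i-natural : ∀ {A B} (h : Hom A B) z →
      i A (G⟨ h ⟩ z) ≐ (Hom.fun h ⊢ i B z)

  Consequence : (A : Structure Sg a) →
                Pred (Structure.Carrier A) a → Structure.Carrier A → Set _
  Consequence A D x = (z : ∣ A ∣) → D ⊆ i A z → x ∈ i A z

  infix 4 Consequence
  syntax Consequence A D x = D ⊢[ A ] x

  Ξ : (A : Structure Sg a) → Pred (Structure.Carrier A) a → ∣ A ∣
  Ξ A = leftAdjoint (G₀ A) (𝒫 A) (i-preserves-infima A)

  Ξ-adjoint : ∀ A → Adjoint (Poset._≤_ (𝒫 A)) (Lat._≤_ A) (Ξ A) (i A)
  Ξ-adjoint A = leftAdjoint-adjoint (G₀ A) (𝒫 A) (i-preserves-infima A)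

{-# OPTIONS --safe #-}
module Submission where

open import Defs
open import Data.Product.Base using (proj₁; proj₂)
open import Function.Bundles using (_⇔_; mk⇔)
open import Relation.Unary using (Pred; _∈_; _⊆_)

-- By the adjunction, `Ξ A D` is the least `z` with `D ⊆ i A z`. Since `i A` is monotone,
-- `i A (Ξ A D)` is then the smallest set of the form `i A z` containing `D`, and lying in all such
-- sets amounts to lying in the smallest.

module _ {s a c ℓ₁ ℓ₂} {Sg : Signature s} (F : FilterPair Sg a c ℓ₁ ℓ₂)
         (A : Structure Sg a) where

  open FilterPair F

  -- If `y ≤ z`, then `y` is the infimum of the pair `y`, `z`, and `i A` preserves it.
  i-monotone : ∀ {y z} → Lat._≤_ A y z → i A y ⊆ i A z
  i-monotone = preservesInfima⇒monotone {P = Lat.poset A} {Q = 𝒫 A} {f = i A}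
    (i-preserves-infima A)

  Ξ-unit : ∀ D → D ⊆ i A (Ξ A D)
  Ξ-unit D = proj₁ (Ξ-adjoint A {D} {Ξ A D}) (Lat.refl A)

  Ξ-least : ∀ D z → D ⊆ i A z → Lat._≤_ A (Ξ A D) z
  Ξ-least D z = proj₂ (Ξ-adjoint A {D} {z})

proposition2p7 : ∀ {s a c ℓ₁ ℓ₂} {Sg : Signature s} (F : FilterPair Sg a c ℓ₁ ℓ₂)
    (A : Structure Sg a)
    (D : Pred (Structure.Carrier A) a) (x : Structure.Carrier A) →
    let open FilterPair F in
    (D ⊢[ A ] x) ⇔ (x ∈ i A (Ξ A D))
proposition2p7 F A D x = mk⇔ to from
  where
  open FilterPair F

  to : D ⊢[ A ] x → x ∈ i A (Ξ A D)
  -- `Ξ A D` is itself one of the `z` quantified over.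
  to D⊢x = D⊢x (Ξ A D) (Ξ-unit F A D)

  from : x ∈ i A (Ξ A D) → D ⊢[ A ] x
  -- Any competing `z` lies above `Ξ A D`, so membership passes upward.
  from x∈iΞD z D⊆iz = i-monotone F A (Ξ-least F A D z D⊆iz) x∈iΞD
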